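{- The function $\mu \colon \mathbb{N}\setminus\{0\} \to \mathbb{N}\setminus\{0\}$ is computable in the limit, i.e. there is a computable function $g(n,k)$ such that for every positive integer $n$, $g(n,k)=\mu(n)$ for all sufficiently large $k$.
   Context: The height of a rational number $\frac{p}{q}$ written in lowest terms is $h\left(\frac{p}{q}\right)=\max(|p|,|q|)$; the height of a rational tuple is $h(x_1,\ldots,x_n)=\max(h(x_1),\ldots,h(x_n))$. For a positive integer $n$, $G_n=\{x_i+1=x_k: i,k \in \{1,\ldots,n\}\} \cup \{x_i \cdot x_j=x_k: i,j,k \in \{1,\ldots,n\}\}$. For a positive integer $n$, $\mu(n)$ denotes the smallest positive integer $m$ such that each system $\mathcal{S}\subseteq G_n$ which is solvable in rationals $x_1,\ldots,x_n$ has a rational solution $(x_1,\ldots,x_n)$ with $h(x_1,\ldots,x_n)\leqslant m$. -}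

module Defs where

open import Data.Nat using (ℕ; _≤_; _⊔_)
open import Data.Integer using (∣_∣)
open import Data.Rational using (ℚ; ↥_; ↧ₙ_; _+_; _*_; 1ℚ)
open import Data.Fin using (Fin)
open import Data.List using (List)
open import Data.List.Relation.Unary.All using (All)
open import Data.Product using (Σ; _×_)
open import Relation.Binary.PropositionalEquality using (_≡_)

-- Equations of G_n over variables x_1..x_n (indexed by Fin n).
data Equation (n : ℕ) : Set where
  plus1 : Fin n → Fin n → Equation n
  times : Fin n → Fin n → Fin n → Equation n

-- A system S ⊆ G_n is given by a (finite) list of its equations.
System : ℕ → Set
System n = List (Equation n)

Assignment : ℕ → Set
Assignment n = Fin n → ℚ

Satisfies : ∀ {n} → Assignment n → Equation n → Set
Satisfies x (plus1 i k) = x i + 1ℚ ≡ x k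
Satisfies x (times i j k) = x i * x j ≡ x k

IsSolution : ∀ {n} → Assignment n → System n → Set
IsSolution x S = All (Satisfies x) S

Solvable : ∀ {n} → System n → Set
Solvable {n} S = Σ (Assignment n) λ x → IsSolution x S

-- height of a rational (ℚ in the stdlib is always in lowest terms)
height : ℚ → ℕ
height q = ∣ ↥ q ∣ ⊔ ↧ₙ q

HeightAtMost : ∀ {n} → Assignment n → ℕ → Set
HeightAtMost x m = ∀ i → height (x i) ≤ m

Bound : ℕ → ℕ → Set
Bound n m = (S : System n) → Solvable S →
  Σ (Assignment n) λ x → IsSolution x S × HeightAtMost x m

IsMu : ℕ → ℕ → Set
IsMu n m = 1 ≤ m × Bound n m × (∀ m′ → 1 ≤ m′ → Bound n m′ → m ≤ m′)

{-# OPTIONS --safe #-}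
-- G_n is finite, so there are finitely many systems S ⊆ G_n and hence,
-- classically, one K such that every solvable S has a solution of height
-- ≤ K; this K is the only non-constructive ingredient.  For k ≥ K, the
-- property "every S with a solution of height ≤ k has one of height ≤ m"
-- is equivalent to the bound property of m, and it is decidable because it
-- quantifies over finitely many systems and over the finitely many
-- rationals of height ≤ k or ≤ m.  It holds for m = k, so searching below
-- k for the least such m ≥ 1 returns μ(n) for every k > K.
module Submission where

open import Defs
open import Data.Nat using (ℕ; zero; suc; _≤_; _<_; _⊔_; z≤n; s≤s; _≤?_)
open import Data.Nat.Properties using (≤-trans; <⇒≤; m≤m⊔n; m≤n⊔m; m⊔n≤o⇒m≤o; m⊔n≤o⇒n≤o)
open import Data.Integer using (ℤ; +_; -[1+_]; ∣_∣)
open import Data.Rational using (ℚ; ↥_; ↧ₙ_; _/_; _+_; _*_; 1ℚ; _≟_)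
open import Data.Rational.Properties using (↥p/↧p≡p)
open import Data.Fin as Fin using (Fin)
open import Data.List using (List; []; _∷_; map; _++_; filter; upTo; allFin; tabulate; cartesianProduct)
open import Data.List.Extrema.Nat using (max; xs≤max)
open import Data.List.Relation.Unary.All as All using (All; []; _∷_)
open import Data.List.Relation.Unary.All.Properties using (all-filter; tabulate⁻)
open import Data.List.Relation.Unary.Any as Any using (Any; any?)
open import Data.List.Membership.Propositional using (_∈_; find; lose)
open import Data.List.Membership.Propositional.Properties
  using (∈-map⁺; ∈-++⁺ˡ; ∈-++⁺ʳ; ∈-upTo⁺; ∈-filter⁺; ∈-filter⁻; ∈-allFin; ∈-cartesianProduct⁺)
open import Data.Vec.Functional as V using (Vector)
open import Data.Vec.Functional.Properties using (∷-cong)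
open import Data.Bool using (true; false)
open import Data.Product using (Σ; ∃; _×_; _,_; proj₂)
open import Function using (_∘_)
open import Effect.Monad using (RawMonad)
open import Relation.Nullary using (¬_; Dec; yes; no; does)
open import Relation.Nullary.Decidable using (map′; _×-dec_; _→-dec_)
open import Relation.Nullary.Negation using (DoubleNegation; ¬¬-Monad; ¬¬-map; contradiction; independence-of-premise)
open import Relation.Unary using (Decidable)
open import Relation.Binary.PropositionalEquality using (_≡_; _≗_; refl; sym; trans; cong₂; subst; subst₂)

least : {P : ℕ → Set} → Decidable P → ℕ → ℕ
least P? zero = zero
least P? (suc b) with P? zero
... | yes _ = zero
... | no _ = suc (least (P? ∘ suc) b)

least-satisfies : {P : ℕ → Set} (P? : Decidable P) (b : ℕ) → P b → P (least P? b)
least-satisfies P? zero pb = pb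
least-satisfies P? (suc b) pb with P? zero
... | yes p0 = p0
... | no _ = least-satisfies (P? ∘ suc) b pb

least-minimal : {P : ℕ → Set} (P? : Decidable P) (b : ℕ) {m : ℕ} → P m → least P? b ≤ m
least-minimal P? zero pm = z≤n
least-minimal P? (suc b) {m} pm with P? zero | m
... | yes _ | _ = z≤n
... | no ¬p0 | zero = contradiction pm ¬p0
... | no _ | suc m′ = s≤s (least-minimal (P? ∘ suc) b pm)

module _ {A : Set} (as : List A) where

  ValuedIn : ∀ {n} → Vector A n → Set
  ValuedIn x = ∀ i → x i ∈ as

  ∃-valuedIn? : ∀ n {P : Vector A n → Set} → (∀ {x y} → x ≗ y → P x → P y) →
                Decidable P → Dec (∃ λ x → ValuedIn x × P x)
  ∃-valuedIn? zero resp P? =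
    map′ (λ p → V.[] , (λ ()) , p) (λ (x , _ , p) → resp (λ ()) p) (P? V.[])
  ∃-valuedIn? (suc n) {P} resp P? =
    map′ fromAny toAny (any? (λ a → ∃-valuedIn? n (resp ∘ ∷-cong refl) (P? ∘ (a V.∷_))) as)
    where
    fromAny : Any (λ a → ∃ λ x → ValuedIn x × P (a V.∷ x)) as → ∃ λ x → ValuedIn x × P x
    fromAny any with find any
    ... | a , a∈ , x , x∈ , p = a V.∷ x , (λ { Fin.zero → a∈ ; (Fin.suc i) → x∈ i }) , p
    toAny : (∃ λ x → ValuedIn x × P x) → Any (λ a → ∃ λ x → ValuedIn x × P (a V.∷ x)) as
    toAny (x , x∈ , p) =
      lose (x∈ Fin.zero) (V.tail x , x∈ ∘ Fin.suc , resp (∷-cong refl (λ _ → refl)) p)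

¬¬-uniformBound : {A : Set} (Q : A → ℕ → Set) → (∀ {a k l} → k ≤ l → Q a k → Q a l) →
                  (∀ a → DoubleNegation (∃ (Q a))) →
                  ∀ as → DoubleNegation (∃ λ K → All (λ a → Q a K) as)
¬¬-uniformBound Q mono bounded [] = contradiction (0 , [])
¬¬-uniformBound Q mono bounded (a ∷ as) = do
  (K , qa) ← bounded a
  (L , qas) ← ¬¬-uniformBound Q mono bounded as
  pure (K ⊔ L , mono (m≤m⊔n K L) qa ∷ All.map (mono (m≤n⊔m K L)) qas)
  where open RawMonad ¬¬-Monad

sublists : {A : Set} → List A → List (List A)
sublists [] = [] ∷ []
sublists (a ∷ as) = map (a ∷_) (sublists as) ++ sublists as

filter∈sublists : {A : Set} {P : A → Set} (P? : Decidable P) (as : List A) →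
                  filter P? as ∈ sublists as
filter∈sublists P? [] = Any.here refl
filter∈sublists P? (a ∷ as) with does (P? a)
... | true = ∈-++⁺ˡ (∈-map⁺ (a ∷_) (filter∈sublists P? as))
... | false = ∈-++⁺ʳ (map (a ∷_) (sublists as)) (filter∈sublists P? as)

integersWithin : ℕ → List ℤ
integersWithin k = map +_ (upTo (suc k)) ++ map -[1+_] (upTo k)

∈-integersWithin : ∀ {k} (z : ℤ) → ∣ z ∣ ≤ k → z ∈ integersWithin k
∈-integersWithin (+ m) h = ∈-++⁺ˡ (∈-map⁺ +_ (∈-upTo⁺ (s≤s h)))
∈-integersWithin {k} -[1+ m ] h = ∈-++⁺ʳ (map +_ (upTo (suc k))) (∈-map⁺ -[1+_] (∈-upTo⁺ h))

fractionsWithin : ℕ → List ℚ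
fractionsWithin k = map (λ (p , d) → p / suc d) (cartesianProduct (integersWithin k) (upTo k))

rationalsWithin : ℕ → List ℚ
rationalsWithin k = filter (λ q → height q ≤? k) (fractionsWithin k)

∈-fractionsWithin : ∀ {k} q → height q ≤ k → q ∈ fractionsWithin k
∈-fractionsWithin {k} q h =
  subst (_∈ fractionsWithin k) (↥p/↧p≡p q)
    (∈-map⁺ (λ (p , d) → p / suc d) (∈-cartesianProduct⁺ num∈ den∈))
  where
  num∈ : ↥ q ∈ integersWithin k
  num∈ = ∈-integersWithin (↥ q) (m⊔n≤o⇒m≤o ∣ ↥ q ∣ (↧ₙ q) h)
  den∈ : ℚ.denominator-1 q ∈ upTo k
  den∈ = ∈-upTo⁺ (m⊔n≤o⇒n≤o ∣ ↥ q ∣ (↧ₙ q) h)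

∈-rationalsWithin⁺ : ∀ {k} q → height q ≤ k → q ∈ rationalsWithin k
∈-rationalsWithin⁺ {k} q h = ∈-filter⁺ (λ q → height q ≤? k) (∈-fractionsWithin q h) h

∈-rationalsWithin⁻ : ∀ {k q} → q ∈ rationalsWithin k → height q ≤ k
∈-rationalsWithin⁻ {k} q∈ =
  proj₂ (∈-filter⁻ (λ q → height q ≤? k) {xs = fractionsWithin k} q∈)

equations : ∀ n → List (Equation n)
equations n =
  map (λ (i , k) → plus1 i k) (cartesianProduct (allFin n) (allFin n)) ++
  map (λ (i , j , k) → times i j k)
      (cartesianProduct (allFin n) (cartesianProduct (allFin n) (allFin n)))

∈-equations : ∀ {n} (e : Equation n) → e ∈ equations n
∈-equations (plus1 i k) = ∈-++⁺ˡ (∈-map⁺ _ (∈-cartesianProduct⁺ (∈-allFin i) (∈-allFin k)))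
∈-equations (times i j k) = ∈-++⁺ʳ _
  (∈-map⁺ _ (∈-cartesianProduct⁺ (∈-allFin i) (∈-cartesianProduct⁺ (∈-allFin j) (∈-allFin k))))

satisfies? : ∀ {n} (x : Assignment n) → Decidable (Satisfies x)
satisfies? x (plus1 i k) = x i + 1ℚ ≟ x k
satisfies? x (times i j k) = x i * x j ≟ x k

isSolution? : ∀ {n} (S : System n) → Decidable (λ x → IsSolution x S)
isSolution? S x = All.all? (satisfies? x) S

satisfies-resp : ∀ {n} {x y : Assignment n} → x ≗ y → ∀ e → Satisfies x e → Satisfies y e
satisfies-resp x≗y (plus1 i k) = subst₂ (λ a b → a + 1ℚ ≡ b) (x≗y i) (x≗y k)
satisfies-resp x≗y (times i j k) s =
  trans (cong₂ _*_ (sym (x≗y i)) (sym (x≗y j))) (trans s (x≗y k))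

isSolution-resp : ∀ {n} (S : System n) {x y : Assignment n} →
                  x ≗ y → IsSolution x S → IsSolution y S
isSolution-resp S x≗y = All.map (satisfies-resp x≗y _)

satisfiedBy : ∀ {n} → Assignment n → System n
satisfiedBy {n} x = filter (satisfies? x) (equations n)

isSolution-satisfiedBy : ∀ {n} (x : Assignment n) → IsSolution x (satisfiedBy x)
isSolution-satisfiedBy {n} x = all-filter (satisfies? x) (equations n)

satisfiedBy-⊇ : ∀ {n} {x y : Assignment n} {S : System n} →
                IsSolution x S → IsSolution y (satisfiedBy x) → IsSolution y S
satisfiedBy-⊇ {x = x} sol soly =
  All.tabulate λ {e} e∈S →
    All.lookup soly (∈-filter⁺ (satisfies? x) (∈-equations e) (All.lookup sol e∈S))

satisfiedBy∈sublists : ∀ {n} (x : Assignment n) → satisfiedBy x ∈ sublists (equations n)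
satisfiedBy∈sublists {n} x = filter∈sublists (satisfies? x) (equations n)

SolvableWithin : ∀ {n} → System n → ℕ → Set
SolvableWithin {n} S m = Σ (Assignment n) λ x → IsSolution x S × HeightAtMost x m

solvableWithin? : ∀ {n} (S : System n) m → Dec (SolvableWithin S m)
solvableWithin? {n} S m =
  map′ (λ (x , x∈ , sol) → x , sol , ∈-rationalsWithin⁻ ∘ x∈)
       (λ (x , sol , h) → x , (λ i → ∈-rationalsWithin⁺ (x i) (h i)) , sol)
       (∃-valuedIn? (rationalsWithin m) n (isSolution-resp S) (isSolution? S))

solvableWithin-mono : ∀ {n} {S : System n} {m m′} →
                      m ≤ m′ → SolvableWithin S m → SolvableWithin S m′
solvableWithin-mono m≤m′ (x , sol , h) = x , sol , λ i → ≤-trans (h i) m≤m′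

solvableWithin-satisfiedBy : ∀ {n} {S : System n} {x : Assignment n} {m} →
  IsSolution x S → SolvableWithin (satisfiedBy x) m → SolvableWithin S m
solvableWithin-satisfiedBy sol (y , soly , h) = y , satisfiedBy-⊇ sol soly , h

heightOf : ∀ {n} → Assignment n → ℕ
heightOf x = max 0 (tabulate (height ∘ x))

heightAtMost-heightOf : ∀ {n} (x : Assignment n) → HeightAtMost x (heightOf x)
heightAtMost-heightOf x = tabulate⁻ (xs≤max 0 (tabulate (height ∘ x)))

Transfers : ℕ → ℕ → ℕ → Set
Transfers n k m = (S : System n) → SolvableWithin S k → SolvableWithin S m

transfers? : ∀ n k m → Dec (Transfers n k m)
transfers? n k m =
  map′ (λ all S (x , sol , h) → solvableWithin-satisfiedBy sol
          (All.lookup all (satisfiedBy∈sublists x) (x , isSolution-satisfiedBy x , h)))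
       (λ t → All.tabulate λ {T} _ → t T)
       (All.all? (λ T → solvableWithin? T k →-dec solvableWithin? T m) (sublists (equations n)))

bound⇒transfers : ∀ {n k m} → Bound n m → Transfers n k m
bound⇒transfers b S (x , sol , _) = b S (x , sol)

transfers⇒bound : ∀ {n K k m} → Bound n K → K ≤ k → Transfers n k m → Bound n m
transfers⇒bound bK K≤k t S solvable = t S (solvableWithin-mono K≤k (bK S solvable))

¬¬-bound : ∀ n → DoubleNegation (∃ (Bound n))
¬¬-bound n = ¬¬-map toBound
  (¬¬-uniformBound (λ T K → Solvable T → SolvableWithin T K)
     (λ K≤L q solvable → solvableWithin-mono K≤L (q solvable))
     (λ T → independence-of-premise 0 λ (x , sol) →
              heightOf x , x , sol , heightAtMost-heightOf x)
     (sublists (equations n)))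
  where
  toBound : (∃ λ K → All (λ T → Solvable T → SolvableWithin T K) (sublists (equations n))) →
            ∃ (Bound n)
  toBound (K , all) = K , λ S (x , sol) → solvableWithin-satisfiedBy sol
    (All.lookup all (satisfiedBy∈sublists x) (x , isSolution-satisfiedBy x))

Admissible : ℕ → ℕ → ℕ → Set
Admissible n k m = 1 ≤ m × Transfers n k m

admissible? : ∀ n k → Decidable (Admissible n k)
admissible? n k m = 1 ≤? m ×-dec transfers? n k m

approxMu : ℕ → ℕ → ℕ
approxMu n k = least (admissible? n k) k

approxMu-isMu : ∀ {n K k} → Bound n K → K < k → IsMu n (approxMu n k)
approxMu-isMu {n} {K} {k} bK K<k
  with least-satisfies (admissible? n k) k (≤-trans (s≤s z≤n) K<k , λ _ sol → sol)
... | 1≤μ , tμ = 1≤μ , transfers⇒bound bK (<⇒≤ K<k) tμ ,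
  λ m′ 1≤m′ bm′ → least-minimal (admissible? n k) k (1≤m′ , bound⇒transfers bm′)

theorem4 : Σ (ℕ → ℕ → ℕ) λ g → (n : ℕ) → 1 ≤ n →
    ¬ ¬ (Σ ℕ λ K → (k : ℕ) → K ≤ k → IsMu n (g n k))
-- μ(0) = 1 is covered by the same argument.
theorem4 = approxMu , λ n _ → ¬¬-map (λ (K , bK) → suc K , λ _ → approxMu-isMu bK) (¬¬-bound n)
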